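{- Let $\alpha\ge 1$ and let $((X,d),\mathcal{H},k)$ be an $\alpha$-metric perturbation resilient instance of a clustering problem with a center-based objective $\mathcal{H}$. Let $C_1,\dots,C_k$ be the unique optimal clustering of this instance, and let $c_1,\dots,c_k$ be a set of centers of $C_1,\dots,C_k$, that is, $c_i\in\operatorname{center}(C_i,d|_{C_i})$ for each $i$. Then the following $\alpha$-center proximity property holds: for all $i\neq j$ and all $p\in C_i$, $$d(p,c_j)>\alpha\, d(p,c_i).$$
   Context: An instance of a clustering problem is a tuple $((X,d),\mathcal{H},k)$, where $(X,d)$ is a metric space, $k>1$ is an integer, and $\mathcal{H}$ (the objective) is a function that, given a partition of $X$ into $k$ (non-empty) sets $C_1,\dots,C_k$ and a metric $d$ on $X$, returns a nonnegative real number $\mathcal{H}(C_1,\dots,C_k;d)$. An optimal clustering is a partition of $X$ into $k$ sets minimizing $\mathcal{H}(C_1,\dots,C_k;d)$. Clusterings are considered as unordered partitions. $\mathcal{H}$ is a center-based objective if the following hold. (1) To every non-empty subset $S\subset X$ and every metric $d_S$ on $S$ there is associated a non-empty set $\operatorname{center}(S,d_S)\subset S$ of optimal centers of $S$ (depending only on $S$ and $d_S$). (2) For every metric $d$ on $X$ there exists an optimal clustering $C_1,\dots,C_k$ of $X$ (one minimizing $\mathcal{H}(C_1,\dots,C_k;d)$) such that for every two distinct clusters $C_i,C_j$, every point $p\in C_i$, and all centers $c_i\in\operatorname{center}(C_i,d|_{C_i})$ and $c_j\in\operatorname{center}(C_j,d|_{C_j})$, we have $d(p,c_i)\le d(p,c_j)$.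 Furthermore, if the optimal clustering $C_1,\dots,C_k$ is unique, then $d(p,c_i)<d(p,c_j)$. An instance $((X,d),\mathcal{H},k)$ is $\alpha$-metric perturbation resilient if for every metric $d'$ on $X$ with $\alpha^{ -1}d(u,v)\le d'(u,v)\le d(u,v)$ for all $u,v\in X$, the instance $((X,d'),\mathcal{H},k)$ has a unique optimal clustering, and it is the same as the unique optimal clustering of $((X,d),\mathcal{H},k)$. (The centers of the clusters may differ between $d$ and $d'$.) -}

module Defs where

open import Algebra.Core using (Op₁; Op₂)
open import Algebra.Structures using (IsCommutativeRing)
open import Data.Fin.Base using (Fin)
open import Data.Fin.Permutation using (Permutation′; _⟨$⟩ʳ_)
open import Data.Nat.Base using (ℕ)
open import Data.Product.Base using (∃; ∃-syntax; Σ-syntax; _×_; _,_; proj₁)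
open import Function.Metric.Structures using (IsGeneralMetric)
open import Level using (Level; _⊔_; suc)
open import Relation.Binary.Bundles using (Setoid)
open import Relation.Binary.Core using (Rel)
import Relation.Binary.Construct.NonStrictToStrict as NonStrictToStrict
import Relation.Binary.Construct.On as On
open import Relation.Binary.Definitions using (_Respects_)
open import Relation.Binary.PropositionalEquality.Core using (_≢_)
open import Relation.Binary.Structures using (IsDecTotalOrder)
open import Relation.Nullary.Negation.Core using (¬_)
open import Relation.Unary using (Pred; Satisfiable; _≐_)

-- The real numbers, given axiomatically as a complete ordered field.  The
-- theory is classical, so the order is total and decidable.

record Reals (r : Level) : Set (suc r) where
  infix  8 _⁻¹ -_
  infixl 7 _*_
  infixl 6 _+_
  infix  4 _≈_ _≤_ _≉_
  field
    Carrier : Set r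
    _≈_ _≤_ : Rel Carrier r
    _+_ _*_ : Op₂ Carrier
    -_ _⁻¹  : Op₁ Carrier
    0# 1#   : Carrier

  _≉_ : Rel Carrier r
  x ≉ y = ¬ (x ≈ y)

  -- x < y  means  x ≤ y and x ≉ y
  open NonStrictToStrict _≈_ _≤_ public using (_<_)

  IsUpperBound : Pred Carrier r → Carrier → Set r
  IsUpperBound P u = ∀ x → P x → x ≤ u

  field
    isCommutativeRing : IsCommutativeRing _≈_ _+_ _*_ -_ 0# 1#
    0≉1               : 0# ≉ 1#
    -- Nothing is assumed about the value of 0# ⁻¹.
    ⁻¹-inverseʳ       : ∀ x → x ≉ 0# → x * x ⁻¹ ≈ 1#
    isDecTotalOrder   : IsDecTotalOrder _≈_ _≤_
    +-monoˡ-≤         : ∀ z {x y} → x ≤ y → x + z ≤ y + z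
    *-nonNegative     : ∀ {x y} → 0# ≤ x → 0# ≤ y → 0# ≤ x * y
    complete          : ∀ (P : Pred Carrier r) → Satisfiable P → ∃ (IsUpperBound P) →
                        ∃[ s ] (IsUpperBound P s × (∀ u → IsUpperBound P u → s ≤ u))

-- A set X is a setoid, and its subsets are the predicates (at a fixed
-- level s) that respect its equality.

module Clustering {r x ℓ : Level} (ℝ : Reals r) (X : Setoid x ℓ) (s : Level) where

  open Reals ℝ
  open Setoid X using () renaming (Carrier to Point; _≈_ to _≈ˣ_)

  record Metric {a ℓ′} (A : Setoid a ℓ′) : Set (r ⊔ a ⊔ ℓ′) where
    open Setoid A using () renaming (Carrier to Pt; _≈_ to _≈ᴬ_)
    field
      dist     : Pt → Pt → Carrier
      isMetric : IsGeneralMetric _≈ᴬ_ _≈_ _≤_ 0# _+_ dist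

  open Metric public

  record Subset : Set (x ⊔ ℓ ⊔ suc s) where
    field
      member   : Pred Point s
      respects : member Respects _≈ˣ_

  open Subset public

  infix 4 _∈_ _≐ˢ_

  _∈_ : Point → Subset → Set s
  p ∈ S = member S p

  _≐ˢ_ : Rel Subset (x ⊔ s)
  S ≐ˢ T = member S ≐ member T

  NonEmpty : Pred Subset (x ⊔ s)
  NonEmpty S = Satisfiable (member S)

  subspace : Subset → Setoid (x ⊔ s) ℓ
  subspace S = On.setoid X (proj₁ {B = member S})

  _∣_ : Metric X → (S : Subset) → Metric (subspace S)
  d ∣ S = record
    { dist     = λ u v → dist d (proj₁ u) (proj₁ v)
    ; isMetric = record
      { isSemiMetric = record
        { isQuasiSemiMetric = record
          { isPreMetric = record
            { isProtoMetric = record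
              { isPartialOrder  = isPartialOrder
              ; ≈-isEquivalence = Setoid.isEquivalence (subspace S)
              ; cong            = cong
              ; nonNegative     = nonNegative
              }
            ; ≈⇒0 = ≈⇒0
            }
          ; 0⇒≈ = 0⇒≈
          }
        ; sym = λ u v → sym (proj₁ u) (proj₁ v)
        }
      ; triangle = λ u v w → triangle (proj₁ u) (proj₁ v) (proj₁ w)
      }
    }
    where open IsGeneralMetric (isMetric d)

  record Clustering (k : ℕ) : Set (x ⊔ ℓ ⊔ suc s) where
    field
      cluster  : Fin k → Subset
      nonEmpty : ∀ i → NonEmpty (cluster i)
      covers   : ∀ p → ∃[ i ] p ∈ cluster i
      disjoint : ∀ {i j} → i ≢ j → ∀ p → ¬ (p ∈ cluster i × p ∈ cluster j)

  open Clustering public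

  -- Clusterings are unordered: they are identified up to relabelling.

  SameClustering : ∀ {k} → Rel (Clustering k) (x ⊔ s)
  SameClustering {k} C D =
    Σ[ π ∈ Permutation′ k ] (∀ i → cluster C i ≐ˢ cluster D (π ⟨$⟩ʳ i))

  -- value-cong says that the value depends only on the unordered partition
  -- and on the distances (functions are not extensional here).

  record Objective (k : ℕ) : Set (r ⊔ x ⊔ ℓ ⊔ suc s) where
    field
      value       : Clustering k → Metric X → Carrier
      nonNegative : ∀ C d → 0# ≤ value C d
      value-cong  : ∀ {C D d e} → SameClustering C D →
                    (∀ u v → dist d u v ≈ dist e u v) →
                    value C d ≈ value D e

  module _ {k : ℕ} (H : Objective k) where
    open Objective H

    IsOptimal : Metric X → Pred (Clustering k) (r ⊔ x ⊔ ℓ ⊔ suc s)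
    IsOptimal d C = ∀ D → value C d ≤ value D d

    IsUniqueOptimal : Metric X → Pred (Clustering k) (r ⊔ x ⊔ ℓ ⊔ suc s)
    IsUniqueOptimal d C = IsOptimal d C × (∀ D → IsOptimal d D → SameClustering C D)

    -- center-cong says that the set of centers depends only on the subset S
    -- and on the distances in S, and not on the witness of non-emptiness.

    record CenterBased : Set (r ⊔ x ⊔ ℓ ⊔ suc s) where
      field
        center          : (S : Subset) → NonEmpty S → Metric (subspace S) → Subset
        center-nonEmpty : ∀ S ne d → NonEmpty (center S ne d)
        center-⊆        : ∀ S ne d p → p ∈ center S ne d → p ∈ S
        center-cong     : ∀ {S T} ne ne′ {d e} → S ≐ˢ T →
                          (∀ u v (u∈S : u ∈ S) (v∈S : v ∈ S)
                                 (u∈T : u ∈ T) (v∈T : v ∈ T) →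
                            dist d (u , u∈S) (v , v∈S) ≈ dist e (u , u∈T) (v , v∈T)) →
                          center S ne d ≐ˢ center T ne′ e

      clusterCenter : Metric X → (C : Clustering k) → Fin k → Subset
      clusterCenter d C i = center (cluster C i) (nonEmpty C i) (d ∣ cluster C i)

      CenterProximity : Rel Carrier r → Metric X → Clustering k → Set (r ⊔ x ⊔ s)
      CenterProximity _∼_ d C =
        ∀ i j → i ≢ j → ∀ p → p ∈ cluster C i →
        ∀ cᵢ cⱼ → cᵢ ∈ clusterCenter d C i → cⱼ ∈ clusterCenter d C j →
        dist d p cᵢ ∼ dist d p cⱼ

      field
        proximity : ∀ d → ∃[ C ] (IsOptimal d C
                                × CenterProximity _≤_ d C
                                × (IsUniqueOptimal d C → CenterProximity _<_ d C))

    IsPerturbation : Carrier → Metric X → Metric X → Set (r ⊔ x)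
    IsPerturbation α d d′ =
      ∀ u v → (α ⁻¹ * dist d u v ≤ dist d′ u v) × (dist d′ u v ≤ dist d u v)

    MetricPerturbationResilient : Carrier → Metric X → Set (r ⊔ x ⊔ ℓ ⊔ suc s)
    MetricPerturbationResilient α d =
      ∃[ C ] (IsUniqueOptimal d C × (∀ d′ → IsPerturbation α d d′ → IsUniqueOptimal d′ C))

{-# OPTIONS --safe #-}
-- Suppose d(p, c j) ≤ α d(p, c i).  Adding to d a shortcut of length d(p, c i)
-- between p and c j gives an α-perturbation d′ of d, so C is still the unique
-- optimal clustering for d′.  Since d satisfies center proximity, no path
-- through the shortcut is shorter than the direct one between two points of
-- C i, or between two points of C j.  Hence d′ and d agree on these clusters,
-- and c i and c j are still centers for d′.  Center proximity for d′ now gives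
-- d(p, c i) = d′(p, c i) < d′(p, c j) ≤ d(p, c i), a contradiction.

module Submission where

open import Algebra.Bundles using (CommutativeRing)
import Algebra.Construct.NaturalChoice.Min as Min
import Algebra.Properties.CommutativeSemigroup as CommutativeSemigroupProperties
import Algebra.Properties.Ring as RingProperties
open import Data.Fin.Base using (Fin)
import Data.Fin.Permutation as Perm
open import Data.Nat.Base using (ℕ) renaming (_<_ to _<ℕ_)
open import Data.Product.Base using (∃-syntax; _,_; proj₁; proj₂)
open import Data.Sum.Base using (inj₁; inj₂)
open import Defs
open import Function.Base using (id; _∘_)
open import Function.Metric.Structures using (IsGeneralMetric)
open import Level using (Level)
open import Relation.Binary.Bundles using (Setoid; DecTotalOrder)
import Relation.Binary.Construct.NonStrictToStrict as NonStrictToStrict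
import Relation.Binary.Reasoning.PartialOrder as PosetReasoning
open import Relation.Binary.Definitions using (Decidable)
open import Relation.Binary.PropositionalEquality.Core as ≡ using (_≢_)
open import Relation.Nullary.Decidable.Core using (decidable-stable)
open import Relation.Nullary.Negation.Core using (¬_; contradiction)

-- Ordered-field arithmetic from the axioms, and scaling by `α ⁻¹` for `1# ≤ α`.

module RealProperties {r : Level} (ℝ : Reals r) where

  open Reals ℝ

  commutativeRing : CommutativeRing r r
  commutativeRing = record { isCommutativeRing = isCommutativeRing }

  decTotalOrder : DecTotalOrder r r r
  decTotalOrder = record { isDecTotalOrder = isDecTotalOrder }

  open DecTotalOrder decTotalOrder public
    using (_≟_; _≤?_; total; antisym; totalOrder; poset)
    renaming (refl to ≤-refl; reflexive to ≤-reflexive; trans to ≤-trans)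

  open CommutativeRing commutativeRing public
    using (ring; +-commutativeSemigroup; +-cong; +-congˡ; +-congʳ; +-assoc; +-comm;
           +-identityˡ; +-identityʳ; -‿inverseʳ; *-congʳ; *-assoc; *-comm;
           *-identityˡ; *-identityʳ; distribˡ; zeroʳ)
    renaming (refl to ≈-refl; sym to ≈-sym; trans to ≈-trans)

  open RingProperties ring using (-1*x≈-x; -‿involutive; x[y-z]≈xy-xz; //-rightDividesˡ)
  open PosetReasoning poset

  ≮⇒≥ : ∀ {x y} → ¬ (x < y) → y ≤ x
  ≮⇒≥ = NonStrictToStrict.≮⇒≥ _≈_ _≤_ ≈-sym _≟_ ≤-reflexive total

  _<?_ : Decidable _<_
  _<?_ = NonStrictToStrict.<-decidable _≈_ _≤_ _≟_ _≤?_

  +-mono-≤ : ∀ {x y u v} → x ≤ y → u ≤ v → x + u ≤ y + v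
  +-mono-≤ {x} {y} {u} {v} x≤y u≤v = begin
    x + u ≤⟨ +-monoˡ-≤ u x≤y ⟩
    y + u ≈⟨ +-comm y u ⟩
    u + y ≤⟨ +-monoˡ-≤ y u≤v ⟩
    v + y ≈⟨ +-comm v y ⟩
    y + v ∎

  x≤y+x : ∀ {x y} → 0# ≤ y → x ≤ y + x
  x≤y+x {x} {y} 0≤y = begin
    x      ≈⟨ +-identityˡ x ⟨
    0# + x ≤⟨ +-monoˡ-≤ x 0≤y ⟩
    y + x  ∎

  x≤x+y : ∀ {x y} → 0# ≤ y → x ≤ x + y
  x≤x+y {x} {y} 0≤y = ≤-trans (x≤y+x 0≤y) (≤-reflexive (+-comm y x))

  x≤y⇒0≤y-x : ∀ {x y} → x ≤ y → 0# ≤ y + - x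
  x≤y⇒0≤y-x {x} {y} x≤y = begin
    0#      ≈⟨ -‿inverseʳ x ⟨
    x + - x ≤⟨ +-monoˡ-≤ (- x) x≤y ⟩
    y + - x ∎

  *-monoˡ-≤ : ∀ {x y z} → 0# ≤ z → x ≤ y → z * x ≤ z * y
  *-monoˡ-≤ {x} {y} {z} 0≤z x≤y = begin
    z * x                          ≤⟨ x≤y+x (*-nonNegative 0≤z (x≤y⇒0≤y-x x≤y)) ⟩
    z * (y + - x) + z * x          ≈⟨ +-congʳ (x[y-z]≈xy-xz z y x) ⟩
    (z * y + - (z * x)) + z * x    ≈⟨ //-rightDividesˡ (z * x) (z * y) ⟩
    z * y                          ∎

  -- If instead `1# ≤ 0#`, then `- 1#` is nonnegative, and so is its square, which is `1#`.
  0≤1 : 0# ≤ 1#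
  0≤1 with total 0# 1#
  ... | inj₁ 0≤1 = 0≤1
  ... | inj₂ 1≤0 = begin
    0#            ≤⟨ *-nonNegative 0≤-1 0≤-1 ⟩
    - 1# * - 1#   ≈⟨ -1*x≈-x (- 1#) ⟩
    - - 1#        ≈⟨ -‿involutive 1# ⟩
    1#            ∎
    where
    0≤-1 : 0# ≤ - 1#
    0≤-1 = ≤-trans (x≤y⇒0≤y-x 1≤0) (≤-reflexive (+-identityˡ (- 1#)))

  1≰0 : ¬ (1# ≤ 0#)
  1≰0 1≤0 = 0≉1 (antisym 0≤1 1≤0)

  module Inverse {α : Carrier} (1≤α : 1# ≤ α) where

    0≤α : 0# ≤ α
    0≤α = ≤-trans 0≤1 1≤α

    α*α⁻¹≈1 : α * α ⁻¹ ≈ 1#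
    α*α⁻¹≈1 = ⁻¹-inverseʳ α λ α≈0 → 1≰0 (≤-trans 1≤α (≤-reflexive α≈0))

    α*[α⁻¹*x]≈x : ∀ x → α * (α ⁻¹ * x) ≈ x
    α*[α⁻¹*x]≈x x = begin-equality
      α * (α ⁻¹ * x) ≈⟨ *-assoc α (α ⁻¹) x ⟨
      α * α ⁻¹ * x   ≈⟨ *-congʳ α*α⁻¹≈1 ⟩
      1# * x         ≈⟨ *-identityˡ x ⟩
      x              ∎

    α⁻¹*[α*x]≈x : ∀ x → α ⁻¹ * (α * x) ≈ x
    α⁻¹*[α*x]≈x x = begin-equality
      α ⁻¹ * (α * x) ≈⟨ *-assoc (α ⁻¹) α x ⟨
      α ⁻¹ * α * x   ≈⟨ *-congʳ (≈-trans (*-comm (α ⁻¹) α) α*α⁻¹≈1) ⟩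
      1# * x         ≈⟨ *-identityˡ x ⟩
      x              ∎

    0≤α⁻¹ : 0# ≤ α ⁻¹
    0≤α⁻¹ with total 0# (α ⁻¹)
    ... | inj₁ 0≤α⁻¹ = 0≤α⁻¹
    ... | inj₂ α⁻¹≤0 = contradiction 1≤0 1≰0
      where
      1≤0 : 1# ≤ 0#
      1≤0 = begin
        1#       ≈⟨ α*α⁻¹≈1 ⟨
        α * α ⁻¹ ≤⟨ *-monoˡ-≤ 0≤α α⁻¹≤0 ⟩
        α * 0#   ≈⟨ zeroʳ α ⟩
        0#       ∎

    α⁻¹*x≤x : ∀ {x} → 0# ≤ x → α ⁻¹ * x ≤ x
    α⁻¹*x≤x {x} 0≤x = begin
      α ⁻¹ * x       ≤⟨ *-monoˡ-≤ 0≤α⁻¹ x≤α*x ⟩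
      α ⁻¹ * (α * x) ≈⟨ α⁻¹*[α*x]≈x x ⟩
      x              ∎
      where
      x≤α*x : x ≤ α * x
      x≤α*x = begin
        x      ≈⟨ *-identityʳ x ⟨
        x * 1# ≤⟨ *-monoˡ-≤ 0≤x 1≤α ⟩
        x * α  ≈⟨ *-comm x α ⟩
        α * x  ∎

    x≤α*y⇒α⁻¹*x≤y : ∀ {x y} → x ≤ α * y → α ⁻¹ * x ≤ y
    x≤α*y⇒α⁻¹*x≤y x≤αy = ≤-trans (*-monoˡ-≤ 0≤α⁻¹ x≤αy) (≤-reflexive (α⁻¹*[α*x]≈x _))

    -- Serves to show that the shortcut metric separates points.
    α⁻¹*x≤0⇒x≤0 : ∀ {x} → α ⁻¹ * x ≤ 0# → x ≤ 0#
    α⁻¹*x≤0⇒x≤0 {x} α⁻¹x≤0 = begin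
      x              ≈⟨ α*[α⁻¹*x]≈x x ⟨
      α * (α ⁻¹ * x) ≤⟨ *-monoˡ-≤ 0≤α α⁻¹x≤0 ⟩
      α * 0#         ≈⟨ zeroʳ α ⟩
      0#             ∎

module _ {r x ℓ s : Level} (ℝ : Reals r) (X : Setoid x ℓ) where

  open Reals ℝ
  open RealProperties ℝ
  open Setoid X using () renaming (Carrier to Point; _≈_ to _≈ˣ_; refl to ≈ˣ-refl)
  open Clustering ℝ X s
  open PosetReasoning poset

  -- The metric `d` with a shortcut of length `w` added between `p` and `q`.

  module Shortcut (d : Metric X) (p q : Point) {w : Carrier} (0≤w : 0# ≤ w) where

    private module d = IsGeneralMetric (isMetric d)
    open Min totalOrder using (_⊓_; ⊓-sel; ⊓-cong; x⊓y≤x; x⊓y≤y)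
    open CommutativeSemigroupProperties +-commutativeSemigroup using (x∙yz≈z∙yx)

    -- The walk goes straight from `u` to `a`, crosses the shortcut to `b`, and goes straight on to
    -- `v`. Keeping `a` and `b` as arguments lets each lemma serve both directions of crossing.
    via : Point → Point → Point → Point → Carrier
    via a b u v = dist d u a + (w + dist d b v)

    via-sym : ∀ a b u v → via a b u v ≈ via b a v u
    via-sym a b u v = begin-equality
      dist d u a + (w + dist d b v) ≈⟨ x∙yz≈z∙yx _ _ _ ⟩
      dist d b v + (w + dist d u a) ≈⟨ +-cong (d.sym b v) (+-congˡ (d.sym u a)) ⟩
      dist d v b + (w + dist d a u) ∎

    via-cong : ∀ a b {u u′ v v′} → u ≈ˣ u′ → v ≈ˣ v′ →
               via a b u v ≈ via a b u′ v′
    via-cong a b u≈u′ v≈v′ =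
      +-cong (d.cong u≈u′ ≈ˣ-refl) (+-congˡ (d.cong ≈ˣ-refl v≈v′))

    dist≤via : ∀ a b u v → dist d u a ≤ via a b u v
    dist≤via a b u v = x≤x+y (≤-trans 0≤w (x≤x+y d.nonNegative))

    w+dist≤via : ∀ a b u v → w + dist d b v ≤ via a b u v
    w+dist≤via a b u v = x≤y+x d.nonNegative

    -- Routes with at most one crossing suffice for a shortest path: two crossings can be replaced
    -- by one or by none, as `concatenate` shows.
    data Route : Set where
      direct forward backward : Route

    length : Route → Point → Point → Carrier
    length direct   = dist d
    length forward  = via p q
    length backward = via q p

    dist′ : Point → Point → Carrier
    dist′ u v = length direct u v ⊓ (length forward u v ⊓ length backward u v)

    dist′≤length : ∀ ρ u v → dist′ u v ≤ length ρ u v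
    dist′≤length direct   u v = x⊓y≤x _ _
    dist′≤length forward  u v = ≤-trans (x⊓y≤y _ _) (x⊓y≤x _ _)
    dist′≤length backward u v = ≤-trans (x⊓y≤y _ _) (x⊓y≤y _ _)

    -- The minimum is attained, so claims about `dist′` reduce to claims about a single route.
    shortest : ∀ u v → ∃[ ρ ] dist′ u v ≈ length ρ u v
    shortest u v
      with ⊓-sel (length direct u v) (length forward u v ⊓ length backward u v)
    ... | inj₁ eq = direct , eq
    ... | inj₂ eq with ⊓-sel (length forward u v) (length backward u v)
    ...   | inj₁ eq′ = forward  , ≈-trans eq eq′
    ...   | inj₂ eq′ = backward , ≈-trans eq eq′

    dist′-glb : ∀ {y u v} → (∀ ρ → y ≤ length ρ u v) → y ≤ dist′ u v
    dist′-glb {u = u} {v} y≤ with ρ , eq ← shortest u v =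
      ≤-trans (y≤ ρ) (≤-reflexive (≈-sym eq))

    length-nonNegative : ∀ ρ {u v} → 0# ≤ length ρ u v
    length-nonNegative direct   = d.nonNegative
    length-nonNegative forward  = ≤-trans d.nonNegative (dist≤via p q _ _)
    length-nonNegative backward = ≤-trans d.nonNegative (dist≤via q p _ _)

    reverse : Route → Route
    reverse direct   = direct
    reverse forward  = backward
    reverse backward = forward

    length-reverse : ∀ ρ u v → length (reverse ρ) v u ≈ length ρ u v
    length-reverse direct   u v = d.sym v u
    length-reverse forward  u v = via-sym q p v u
    length-reverse backward u v = via-sym p q v u

    dist-via : ∀ a b t u v → via a b t v ≤ dist d t u + via a b u v
    dist-via a b t u v = begin
      dist d t a + (w + dist d b v)                ≤⟨ +-monoˡ-≤ _ (d.triangle t u a) ⟩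
      dist d t u + dist d u a + (w + dist d b v)   ≈⟨ +-assoc _ _ _ ⟩
      dist d t u + (dist d u a + (w + dist d b v)) ∎

    via-dist : ∀ a b t u v → via a b t v ≤ via a b t u + dist d u v
    via-dist a b t u v = begin
      dist d t a + (w + dist d b v)
        ≤⟨ +-mono-≤ ≤-refl (+-mono-≤ ≤-refl (d.triangle b u v)) ⟩
      dist d t a + (w + (dist d b u + dist d u v))
        ≈⟨ +-congˡ (+-assoc _ _ _) ⟨
      dist d t a + (w + dist d b u + dist d u v)
        ≈⟨ +-assoc _ _ _ ⟨
      dist d t a + (w + dist d b u) + dist d u v ∎

    -- Two crossings in the same direction: keep the first leg of the first walk, and the crossing
    -- and last leg of the second. What is dropped is nonnegative.
    via-via : ∀ a b t u v → via a b t v ≤ via a b t u + via a b u v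
    via-via a b t u v = +-mono-≤ (dist≤via a b t u) (w+dist≤via a b u v)

    -- Crossing and coming back returns to `a`, so the first and last legs alone already join `t` to
    -- `v` through `a`.
    via-via⁻¹ : ∀ a b t u v → dist d t v ≤ via a b t u + via b a u v
    via-via⁻¹ a b t u v = ≤-trans (d.triangle t a v)
      (+-mono-≤ (dist≤via a b t u) (≤-trans (x≤y+x 0≤w) (w+dist≤via b a u v)))

    -- This is the core of the triangle inequality for `dist′`, applied to shortest routes `ρ` and
    -- `σ`. Opposite crossings cancel, equal ones merge.
    concatenate : ∀ ρ σ t u v → ∃[ τ ] length τ t v ≤ length ρ t u + length σ u v
    concatenate direct   direct   t u v = direct   , d.triangle t u v
    concatenate direct   forward  t u v = forward  , dist-via p q t u v
    concatenate direct   backward t u v = backward , dist-via q p t u v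
    concatenate forward  direct   t u v = forward  , via-dist p q t u v
    concatenate forward  forward  t u v = forward  , via-via p q t u v
    concatenate forward  backward t u v = direct   , via-via⁻¹ p q t u v
    concatenate backward direct   t u v = backward , via-dist q p t u v
    concatenate backward forward  t u v = direct   , via-via⁻¹ q p t u v
    concatenate backward backward t u v = backward , via-via q p t u v

    dist′-triangle : ∀ t u v → dist′ t v ≤ dist′ t u + dist′ u v
    dist′-triangle t u v
      with ρ , eqρ ← shortest t u | σ , eqσ ← shortest u v
      with τ , τ≤ρ+σ ← concatenate ρ σ t u v = begin
        dist′ t v                   ≤⟨ dist′≤length τ t v ⟩
        length τ t v                ≤⟨ τ≤ρ+σ ⟩
        length ρ t u + length σ u v ≈⟨ +-cong eqρ eqσ ⟨
        dist′ t u + dist′ u v       ∎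

    dist′-sym-≤ : ∀ u v → dist′ u v ≤ dist′ v u
    dist′-sym-≤ u v = dist′-glb λ ρ →
      ≤-trans (dist′≤length (reverse ρ) u v) (≤-reflexive (length-reverse ρ v u))

    -- The backward route from `u` to `v` is the forward route from `v` to `u` reversed, so bounds
    -- on `via p q` in both orders of the points cover all routes.
    dist′≈dist : ∀ {u v} → dist d u v ≤ via p q u v → dist d v u ≤ via p q v u →
                 dist d u v ≈ dist′ u v
    dist′≈dist {u} {v} uv vu = antisym (dist′-glb bound) (dist′≤length direct u v)
      where
      bound : ∀ ρ → dist d u v ≤ length ρ u v
      bound direct   = ≤-refl
      bound forward  = uv
      bound backward = begin
        dist d u v  ≈⟨ d.sym u v ⟩
        dist d v u  ≤⟨ vu ⟩
        via p q v u ≈⟨ via-sym p q v u ⟩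
        via q p u v ∎

    module _ {α : Carrier} (1≤α : 1# ≤ α) (pq≤αw : dist d p q ≤ α * w) where

      open Inverse 1≤α

      -- Apply the triangle inequality along `u`, `a`, `b`, `v` and scale by `α ⁻¹`: the outer legs
      -- do not grow, and the middle leg drops to at most `w` by hypothesis.
      α⁻¹*dist≤via : ∀ {a b} → dist d a b ≤ α * w → ∀ u v → α ⁻¹ * dist d u v ≤ via a b u v
      α⁻¹*dist≤via {a} {b} ab≤αw u v = begin
        α ⁻¹ * dist d u v
          ≤⟨ *-monoˡ-≤ 0≤α⁻¹ (≤-trans (d.triangle u a v) (+-mono-≤ ≤-refl (d.triangle a b v))) ⟩
        α ⁻¹ * (dist d u a + (dist d a b + dist d b v))
          ≈⟨ distribˡ _ _ _ ⟩
        α ⁻¹ * dist d u a + α ⁻¹ * (dist d a b + dist d b v)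
          ≈⟨ +-congˡ (distribˡ _ _ _) ⟩
        α ⁻¹ * dist d u a + (α ⁻¹ * dist d a b + α ⁻¹ * dist d b v)
          ≤⟨ +-mono-≤ (α⁻¹*x≤x d.nonNegative)
               (+-mono-≤ (x≤α*y⇒α⁻¹*x≤y ab≤αw) (α⁻¹*x≤x d.nonNegative)) ⟩
        via a b u v ∎

      α⁻¹*dist≤dist′ : ∀ u v → α ⁻¹ * dist d u v ≤ dist′ u v
      α⁻¹*dist≤dist′ u v = dist′-glb bound
        where
        bound : ∀ ρ → α ⁻¹ * dist d u v ≤ length ρ u v
        bound direct   = α⁻¹*x≤x d.nonNegative
        bound forward  = α⁻¹*dist≤via pq≤αw u v
        bound backward = α⁻¹*dist≤via (≤-trans (≤-reflexive (d.sym q p)) pq≤αw) u v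

      shortcut : Metric X
      shortcut = record
        { dist     = dist′
        ; isMetric = record
          { isSemiMetric = record
            { isQuasiSemiMetric = record
              { isPreMetric = record
                { isProtoMetric = record
                  { isPartialOrder  = d.isPartialOrder
                  ; ≈-isEquivalence = d.≈-isEquivalence
                  ; cong            = λ t≈u v≈w → ⊓-cong (d.cong t≈u v≈w)
                      (⊓-cong (via-cong p q t≈u v≈w) (via-cong q p t≈u v≈w))
                  ; nonNegative     = dist′-nonNegative
                  }
                ; ≈⇒0 = λ u≈v → antisym
                    (≤-trans (dist′≤length direct _ _) (≤-reflexive (d.≈⇒0 u≈v)))
                    dist′-nonNegative
                }
              -- The lower perturbation bound makes `dist d u v` vanish along with `dist′ u v`. This
              -- covers `w ≈ 0#` too, where `pq≤αw` forces `p` and `q` to coincide.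
              ; 0⇒≈ = λ {u} {v} d′≈0 → d.0⇒≈ (antisym
                  (α⁻¹*x≤0⇒x≤0 (≤-trans (α⁻¹*dist≤dist′ u v) (≤-reflexive d′≈0)))
                  d.nonNegative)
              }
            ; sym = λ u v → antisym (dist′-sym-≤ u v) (dist′-sym-≤ v u)
            }
          ; triangle = dist′-triangle
          }
        }
        where
        dist′-nonNegative : ∀ {u v} → 0# ≤ dist′ u v
        dist′-nonNegative = dist′-glb λ ρ → length-nonNegative ρ

      shortcut-isPerturbation : ∀ {k} (H : Objective k) → IsPerturbation H α d shortcut
      shortcut-isPerturbation H u v = α⁻¹*dist≤dist′ u v , dist′≤length direct u v

  -- Relabelling of clusters, unique optimality and center proximity.

  module _ {k : ℕ} where

    SameClustering-sym : ∀ {C D : Clustering k} → SameClustering C D → SameClustering D C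
    SameClustering-sym {C} {D} (π , C≐D) = Perm.flip π , λ i →
      -- `C≐D` at the preimage of `i` concerns the cluster of `D` at the image of that preimage, an
      -- index only propositionally equal to `i`.
      let D≐D = ≡.subst (λ j → cluster D j ≐ˢ cluster D i) (≡.sym (Perm.inverseʳ π)) (id , id)
          ⊆ , ⊇ = C≐D (π Perm.⟨$⟩ˡ i)
      in ⊇ ∘ proj₂ D≐D , proj₁ D≐D ∘ ⊆

    SameClustering-trans : ∀ {C D E : Clustering k} →
                           SameClustering C D → SameClustering D E → SameClustering C E
    SameClustering-trans (π , C≐D) (ρ , D≐E) = π Perm.∘ₚ ρ , λ i →
      proj₁ (D≐E (π Perm.⟨$⟩ʳ i)) ∘ proj₁ (C≐D i) ,
      proj₂ (C≐D i) ∘ proj₂ (D≐E (π Perm.⟨$⟩ʳ i))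

  module _ {k : ℕ} (H : Objective k) where

    open Objective H

    IsUniqueOptimal-resp : ∀ {d} {C D : Clustering k} → SameClustering C D →
                           IsUniqueOptimal H d C → IsUniqueOptimal H d D
    IsUniqueOptimal-resp {d} {C} {D} C~D (optimal , unique) =
      (λ E → begin
        value D d ≈⟨ value-cong {C} {D} {d} {d} C~D (λ _ _ → ≈-refl) ⟨
        value C d ≤⟨ optimal E ⟩
        value E d ∎) ,
      λ E E-optimal → SameClustering-trans {C = D} {C} {E}
        (SameClustering-sym {C = C} {D} C~D) (unique E E-optimal)

    -- Resilience carries its own clustering `C₀`; uniqueness of `C₀` for `d` identifies it with `C`
    -- up to relabelling.
    resilient⇒uniqueOptimal : ∀ {α d C} → MetricPerturbationResilient H α d → IsOptimal H d C →
                              ∀ d′ → IsPerturbation H α d d′ → IsUniqueOptimal H d′ C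
    resilient⇒uniqueOptimal {C = C} (C₀ , (_ , unique) , stable) C-optimal d′ pert =
      IsUniqueOptimal-resp {d′} {C₀} {C} (unique C C-optimal) (stable d′ pert)

    module _ (centerBased : CenterBased H) where

      open CenterBased centerBased

      -- The axiom speaks of some optimal clustering `D`. Uniqueness makes `D` a relabelling of `C`,
      -- hence itself uniquely optimal, and its strict proximity is read back along `π`.
      uniqueOptimal⇒proximity : ∀ {d C} → IsUniqueOptimal H d C → CenterProximity _<_ d C
      uniqueOptimal⇒proximity {d} {C} C-unique i j i≢j p p∈Cᵢ cᵢ cⱼ cᵢ-center cⱼ-center
        with D , D-optimal , _ , <-proximity ← proximity d
        with π , C≐D ← proj₂ C-unique D D-optimal =
        <-proximity (IsUniqueOptimal-resp {d} {C} {D} (π , C≐D) C-unique)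
          (π Perm.⟨$⟩ʳ i) (π Perm.⟨$⟩ʳ j) πi≢πj p (proj₁ (C≐D i) p∈Cᵢ) cᵢ cⱼ
          (relabel i cᵢ-center) (relabel j cⱼ-center)
        where
        πi≢πj : π Perm.⟨$⟩ʳ i ≢ π Perm.⟨$⟩ʳ j
        πi≢πj eq = i≢j (≡.trans (≡.sym (Perm.inverseˡ π))
          (≡.trans (≡.cong (π Perm.⟨$⟩ˡ_) eq) (Perm.inverseˡ π)))

        relabel : ∀ m {c} → c ∈ clusterCenter d C m → c ∈ clusterCenter d D (π Perm.⟨$⟩ʳ m)
        relabel m = proj₁ (center-cong _ _
          {d ∣ cluster C m} {d ∣ cluster D (π Perm.⟨$⟩ʳ m)} (C≐D m) λ _ _ _ _ _ _ → ≈-refl)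

      -- Centers depend only on distances inside the cluster, so they survive a change of metric
      -- that alters only distances between clusters.
      clusterCenter-agree : ∀ d e (C : Clustering k) i →
        (∀ u v → u ∈ cluster C i → v ∈ cluster C i → dist d u v ≈ dist e u v) →
        ∀ {c} → c ∈ clusterCenter d C i → c ∈ clusterCenter e C i
      clusterCenter-agree d e C i d≈e = proj₁ (center-cong _ _
        {d ∣ cluster C i} {e ∣ cluster C i} (id , id) λ u v u∈C v∈C _ _ → d≈e u v u∈C v∈C)

-- Center proximity with factor `α`, by a shortcut from `p` to `c j`.

theorem3p1 : {r x ℓ s : Level} (ℝ : Reals r) (X : Setoid x ℓ) →
    let open Reals ℝ
        open Clustering ℝ X s
    in
    (d : Metric X) (k : ℕ) → 1 <ℕ k →
    (H : Objective k) (centerBased : CenterBased H) →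
    let open CenterBased centerBased using (clusterCenter) in
    (α : Carrier) → 1# ≤ α →
    MetricPerturbationResilient H α d →
    (C : Clustering k) → IsUniqueOptimal H d C →
    (c : Fin k → Setoid.Carrier X) → (∀ i → c i ∈ clusterCenter d C i) →
    ∀ i j → i ≢ j → ∀ p → p ∈ cluster C i →
    α * dist d p (c i) < dist d p (c j)
theorem3p1 {s = s} ℝ X d k _ H centerBased α 1≤α resilient C C-unique c c-center i j i≢j p p∈Cᵢ =
  decidable-stable (_ <? _) λ αr≮pcⱼ → shortcut-contradiction (≮⇒≥ αr≮pcⱼ)
  where
  open Reals ℝ
  open RealProperties ℝ
  open Clustering ℝ X s
  open CenterBased centerBased
  open PosetReasoning poset
  module d = IsGeneralMetric (isMetric d)

  -- With this length, the negation of the goal reads `dist d p (c j) ≤ α * w`, which is exactly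
  -- what makes the shortcut metric an `α`-perturbation.
  w : Carrier
  w = dist d p (c i)

  open Shortcut {s = s} ℝ X d p (c j) {w} d.nonNegative

  d-proximity : CenterProximity _<_ d C
  d-proximity = uniqueOptimal⇒proximity ℝ X H centerBased {d} {C} C-unique

  c∈C : ∀ m → c m ∈ cluster C m
  c∈C m = center-⊆ (cluster C m) (nonEmpty C m) (d ∣ cluster C m) (c m) (c-center m)

  -- The detour through `p` and `c i` costs `w` between these two, as the shortcut does, and then
  -- `v` is closer to its own center `c i` than to `c j`.
  dist≤viaᵢ : ∀ u v → v ∈ cluster C i → dist d u v ≤ via p (c j) u v
  dist≤viaᵢ u v v∈Cᵢ = begin
    dist d u v                                    ≤⟨ d.triangle u p v ⟩
    dist d u p + dist d p v                       ≤⟨ +-mono-≤ ≤-refl (d.triangle p (c i) v) ⟩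
    dist d u p + (w + dist d (c i) v)             ≈⟨ +-congˡ (+-congˡ (d.sym (c i) v)) ⟩
    dist d u p + (w + dist d v (c i))
      ≤⟨ +-mono-≤ ≤-refl (+-mono-≤ ≤-refl
           (proj₁ (d-proximity i j i≢j v v∈Cᵢ (c i) (c j) (c-center i) (c-center j)))) ⟩
    dist d u p + (w + dist d v (c j))             ≈⟨ +-congˡ (+-congˡ (d.sym v (c j))) ⟩
    via p (c j) u v                               ∎

  -- Here `u` is closer to its own center `c j` than to `c i`, and reaching `c i` by way of `p`
  -- costs `dist d u p + w`, the price of reaching `c j` by the shortcut.
  dist≤viaⱼ : ∀ u v → u ∈ cluster C j → dist d u v ≤ via p (c j) u v
  dist≤viaⱼ u v u∈Cⱼ = begin
    dist d u v                             ≤⟨ d.triangle u (c j) v ⟩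
    dist d u (c j) + dist d (c j) v
      ≤⟨ +-monoˡ-≤ _
           (proj₁ (d-proximity j i (i≢j ∘ ≡.sym) u u∈Cⱼ (c j) (c i) (c-center j) (c-center i))) ⟩
    dist d u (c i) + dist d (c j) v        ≤⟨ +-monoˡ-≤ _ (d.triangle u p (c i)) ⟩
    dist d u p + w + dist d (c j) v        ≈⟨ +-assoc _ _ _ ⟩
    via p (c j) u v                        ∎

  agreeᵢ : ∀ u v → u ∈ cluster C i → v ∈ cluster C i → dist d u v ≈ dist′ u v
  agreeᵢ u v u∈Cᵢ v∈Cᵢ = dist′≈dist (dist≤viaᵢ u v v∈Cᵢ) (dist≤viaᵢ v u u∈Cᵢ)

  agreeⱼ : ∀ u v → u ∈ cluster C j → v ∈ cluster C j → dist d u v ≈ dist′ u v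
  agreeⱼ u v u∈Cⱼ v∈Cⱼ = dist′≈dist (dist≤viaⱼ u v u∈Cⱼ) (dist≤viaⱼ v u v∈Cⱼ)

  shortcut-contradiction : ¬ (dist d p (c j) ≤ α * w)
  shortcut-contradiction pcⱼ≤αw = begin-contradiction
    w                                   ≈⟨ agreeᵢ p (c i) p∈Cᵢ (c∈C i) ⟩
    dist′ p (c i)                       <⟨ d′-proximity ⟩
    -- The forward route from `p` to `c j` is the bare shortcut: both outer legs have length zero.
    -- The chain closes as `w < w`.
    dist′ p (c j)                       ≤⟨ dist′≤length forward p (c j) ⟩
    dist d p p + (w + dist d (c j) (c j))
      ≈⟨ +-cong (d.≈⇒0 (Setoid.refl X)) (+-congˡ (d.≈⇒0 (Setoid.refl X))) ⟩
    0# + (w + 0#)                       ≈⟨ +-identityˡ _ ⟩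
    w + 0#                              ≈⟨ +-identityʳ w ⟩
    w                                   ∎
    where
    d′ : Metric X
    d′ = shortcut 1≤α pcⱼ≤αw

    d′-unique : IsUniqueOptimal H d′ C
    d′-unique = resilient⇒uniqueOptimal ℝ X H {d = d} {C} resilient (proj₁ C-unique) d′
      (shortcut-isPerturbation 1≤α pcⱼ≤αw H)

    d′-proximity : dist′ p (c i) < dist′ p (c j)
    d′-proximity = uniqueOptimal⇒proximity ℝ X H centerBased {d′} {C} d′-unique
      i j i≢j p p∈Cᵢ (c i) (c j)
      (clusterCenter-agree ℝ X H centerBased d d′ C i agreeᵢ (c-center i))
      (clusterCenter-agree ℝ X H centerBased d d′ C j agreeⱼ (c-center j))
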